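{- Let $P=(Q,I,M,\Delta)$ be a broadcast protocol, let $F\subseteq Q$, and let $S$ be the set of states returned by the saturation algorithm on input $P$. If $F\cap S\neq\emptyset$, then there exists a reconfigurable execution $\rho$ covering $F$ such that $\rho$ has at most $2|Q|$ nodes and length at most $2|Q|^2$.
   Context: A broadcast protocol is a tuple $P=(Q,I,M,\Delta)$ where $Q$ is a finite set of states, $I\subseteq Q$ is the set of initial states, $M$ is a finite message alphabet and $\Delta\subseteq Q\times\{!!m,\ ??m \mid m\in M\}\times Q$ is the transition relation ($!!m$ = broadcast of $m$, $??m$ = reception of $m$). Protocols are assumed complete for receptions: for every $q\in Q$ and $m\in M$ there is $q'$ with $(q,??m,q')\in\Delta$. A configuration is a finite undirected graph $\gamma=(V,E,L)$ with $E\subseteq V\times V$ symmetric and irreflexive and $L:V\to Q$; $L(\gamma)$ denotes the set $L(V)$ of labels occurring in $\gamma$; $\gamma$ is initial if $L(V)\subseteq I$. For $v\in V$, its neighbours are the $v'$ with $(v,v')\in E$. A reconfigurable step goes from $\gamma=(V,E,L)$ to $\gamma'=(V,E',L')$ (same node set, arbitrary new edge set $E'$) if there exist a node $v$ and a message $m$ with $(L(v),!!m,L'(v))\in\Delta$ and, for every $v'\neq v$: if $v'$ is a neighbour of $v$ in $E$ then $(L(v'),??m,L'(v'))\in\Delta$, otherwise $L'(v')=L(v')$; $v$ is then said to broadcast in this step. A reconfigurable execution is a sequence $\gamma_0,\dots,\gamma_r$ of configurations over a fixed node set with $\gamma_0$ initial and each $\gamma_i\to\gamma_{i+1}$ a reconfigurable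 step; its number of nodes is $|V|$, its length is $r$, and it covers $F$ if $L(\gamma_r)\cap F\neq\emptyset$. The saturation algorithm on input $P$: start with $S:=I$, $c:=|I|$; repeat: if there is $(q_1,!!m,q_2)\in\Delta$ with $q_1\in S$, $q_2\notin S$, add $q_2$ to $S$ and set $c:=c+1$; else if there are $(q_1,!!m,q_2)\in\Delta$ and $(q_1',??m,q_2')\in\Delta$ with $q_1,q_2,q_1'\in S$ and $q_2'\notin S$, add $q_2'$ to $S$ and set $c:=c+2$; else stop and return $S$ (choices among candidates are arbitrary). -}

module Defs where

open import Level using (0ℓ)
open import Data.Nat.Base using (ℕ; suc; _+_)
open import Data.Fin.Base using (Fin; suc; fromℕ; inject₁)
open import Data.Fin.Subset using (Subset; _∈_; _∉_; _∪_; ⁅_⁆; ∣_∣)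
open import Data.Product.Base using (_×_; _,_; ∃; ∃-syntax)
open import Data.Vec.Functional using (Vector)
open import Relation.Binary.Core using (Rel)
open import Relation.Binary.Definitions using (Decidable; Symmetric; Irreflexive)
open import Relation.Binary.Construct.Closure.ReflexiveTransitive using (Star)
open import Relation.Binary.PropositionalEquality.Core using (_≡_; _≢_)
open import Relation.Nullary using (¬_; Dec)
open import Relation.Unary using (Pred; _⊆_; _≬_)

data Action (M : Set) : Set where
  !! ?? : M → Action M

-- The state set and the message alphabet are Fin ∣Q∣ and Fin ∣M∣.  Subsets
-- of a finite set are decidable, hence the field Δ?.
record Protocol : Set₁ where
  field
    ∣Q∣ ∣M∣ : ℕ

  Q : Set
  Q = Fin ∣Q∣

  M : Set
  M = Fin ∣M∣

  field
    I        : Subset ∣Q∣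
    Δ        : Q → Action M → Q → Set
    Δ?       : ∀ q a q′ → Dec (Δ q a q′)
    complete : ∀ q m → ∃[ q′ ] Δ q (?? m) q′

module _ (P : Protocol) where
  open Protocol P

  record Configuration (n : ℕ) : Set₁ where
    field
      E        : Rel (Fin n) 0ℓ
      E?       : Decidable E
      E-sym    : Symmetric E
      E-irrefl : Irreflexive _≡_ E
      L        : Fin n → Q

    labels : Pred Q 0ℓ
    labels q = ∃[ v ] L v ≡ q

  open Configuration

  Initial : ∀ {n} → Configuration n → Set
  Initial γ = labels γ ⊆ (_∈ I)

  -- The edges of γ and γ′ are unrelated: reconfiguration is unconstrained.
  record Step {n : ℕ} (γ γ′ : Configuration n) : Set where
    field
      v          : Fin n
      m          : M
      broadcasts : Δ (L γ v) (!! m) (L γ′ v)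
      receives   : ∀ v′ → v′ ≢ v → E γ v v′ → Δ (L γ v′) (?? m) (L γ′ v′)
      idles      : ∀ v′ → v′ ≢ v → ¬ E γ v v′ → L γ′ v′ ≡ L γ v′

  record Execution : Set₁ where
    field
      nodes   : ℕ
      length  : ℕ
      configs : Vector (Configuration nodes) (suc length)
      initial : Initial (configs Fin.zero)
      steps   : ∀ i → Step (configs (inject₁ i)) (configs (suc i))

  Covers : Execution → Subset ∣Q∣ → Set
  Covers ρ F = labels (configs (fromℕ length)) ≬ (_∈ F)
    where open Execution ρ

  BroadcastCandidate : Subset ∣Q∣ → Q → Set
  BroadcastCandidate S q₂ =
    ∃[ q₁ ] ∃[ m ] Δ q₁ (!! m) q₂ × q₁ ∈ S × q₂ ∉ S

  ReceptionCandidate : Subset ∣Q∣ → Q → Set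
  ReceptionCandidate S q₂′ =
    ∃[ q₁ ] ∃[ q₂ ] ∃[ q₁′ ] ∃[ m ]
      Δ q₁ (!! m) q₂ × Δ q₁′ (?? m) q₂′ ×
      q₁ ∈ S × q₂ ∈ S × q₁′ ∈ S × q₂′ ∉ S

  -- One iteration of the saturation loop on the pair (S , c).  It is a
  -- relation because the choice among candidates is arbitrary.
  data Iteration : Rel (Subset ∣Q∣ × ℕ) 0ℓ where
    by-broadcast : ∀ {S c} q → BroadcastCandidate S q →
                   Iteration (S , c) (S ∪ ⁅ q ⁆ , c + 1)
    by-reception : ∀ {S c} q → (∀ q₂ → ¬ BroadcastCandidate S q₂) →
                   ReceptionCandidate S q →
                   Iteration (S , c) (S ∪ ⁅ q ⁆ , c + 2)

  record SaturationReturns (S : Subset ∣Q∣) : Set where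
    field
      c            : ℕ
      run          : Star Iteration (I , ∣ I ∣) (S , c)
      no-broadcast : ∀ q → ¬ BroadcastCandidate S q
      no-reception : ∀ q → ¬ ReceptionCandidate S q

{-# OPTIONS --safe #-}

-- A node budget of one more than the number k of iterations suffices.  Work
-- backwards from a demand, i.e. a state prescribed for each node.  To meet a
-- demand on the saturated set after an iteration that added q, first meet the
-- demand in which q is replaced by a state q₁ it was obtained from.  If q was
-- added by broadcast, each node concerned then broadcasts in isolation.  If q
-- was added by reception, a single broadcast by one extra node, on which no
-- demand was left, moves all the nodes concerned at once.  Every iteration thus
-- costs one node and at most as many steps as there are nodes, which gives
-- 1 + k nodes and k (1 + k) steps, with k ≤ ∣ S ∣ ≤ ∣Q∣ and ∣Q∣ ≥ 1.
module Submission where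

open import Defs
open import Data.Empty using (⊥)
open import Data.Nat.Base using (ℕ; suc; _+_; _≤_; _<_; z≤n; s≤s; _*_; _^_)
open import Data.Nat.Properties as ℕ using (_≤?_; module ≤-Reasoning)
open import Data.Fin.Base as Fin using (Fin; suc; fromℕ; fromℕ<; inject₁; toℕ)
open import Data.Fin.Properties using (_≟_; toℕ<n; toℕ-fromℕ; toℕ-fromℕ<)
open import Data.Fin.Subset using (Subset; _∈_; _∉_; _∪_; ⁅_⁆; ∣_∣; _∩_; Nonempty)
open import Data.Fin.Subset.Properties
  using (∣p∣≤n; p⊂q⇒∣p∣<∣q∣; p⊆p∪q; x∈p∪q⁺; x∈p∪q⁻; x∈p∩q⁻; x∈⁅x⁆; x∈⁅y⁆⇒x≡y)
open import Data.List.Base as List using (List; []; _∷_; allFin)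
open import Data.List.Membership.Propositional using () renaming (_∈_ to _∈ˡ_)
open import Data.List.Membership.Propositional.Properties using (∈-allFin)
open import Data.List.Properties using (length-tabulate)
open import Data.List.Relation.Unary.Any using (here; there)
open import Data.Product.Base using (_×_; _,_; ∃-syntax)
open import Data.Sum.Base using (_⊎_; inj₁; inj₂; swap; [_,_]′)
open import Data.Vec.Functional as Vector using (Vector; updateAt)
open import Data.Vec.Functional.Properties using (updateAt-updates; updateAt-minimal)
open import Function.Base using (id; const; _∘_)
open import Level using (0ℓ)
open import Relation.Binary.Construct.Closure.ReflexiveTransitive using (Star; ε; _◅_)
open import Relation.Binary.PropositionalEquality
open import Relation.Nullary using (¬_; Dec; yes; no; contradiction; ¬?; _×-dec_; _⊎-dec_)
open import Relation.Unary using (Pred; Decidable)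

module _ (P : Protocol) where
  open Protocol P

  -- Runs of labellings and their realisation by graphs.

  module _ {N : ℕ} where

    -- A step with the graph forgotten: since edges can be rewired freely, it is enough to name a
    -- set `R` of nodes that hear `v`.
    record Transition (L L′ : Vector Q N) : Set₁ where
      field
        v          : Fin N
        m          : M
        R          : Pred (Fin N) 0ℓ
        R?         : Decidable R
        broadcasts : Δ (L v) (!! m) (L′ v)
        receives   : ∀ i → i ≢ v → R i → Δ (L i) (?? m) (L′ i)
        idles      : ∀ i → i ≢ v → ¬ R i → L′ i ≡ L i

    infixr 5 _∷_ _++_

    data Run : ℕ → Vector Q N → Vector Q N → Set₁ where
      []  : ∀ {L} → Run 0 L L
      _∷_ : ∀ {ℓ L L′ L″} → Transition L L′ → Run ℓ L′ L″ → Run (suc ℓ) L L″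

    _++_ : ∀ {k ℓ L L′ L″} → Run k L L′ → Run ℓ L′ L″ → Run (k + ℓ) L L″
    []       ++ ys = ys
    (x ∷ xs) ++ ys = x ∷ (xs ++ ys)

    -- `R` may contain `v`, so `Ray` excludes `v` as a leaf; otherwise the graph could have a loop.
    starGraph : Vector Q N → (v : Fin N) {R : Pred (Fin N) 0ℓ} → Decidable R →
                Configuration P N
    starGraph L v {R} R? = record
      { E        = λ i j → Ray i j ⊎ Ray j i
      ; E?       = λ i j → Ray? i j ⊎-dec Ray? j i
      ; E-sym    = swap
      ; E-irrefl = λ { refl → [ irrefl , irrefl ]′ }
      ; L        = L
      }
      where
      Ray : Fin N → Fin N → Set
      Ray i j = i ≡ v × j ≢ v × R j

      Ray? : ∀ i j → Dec (Ray i j)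
      Ray? i j = (i ≟ v) ×-dec (¬? (j ≟ v) ×-dec R? j)

      irrefl : ∀ {i} → ¬ Ray i i
      irrefl (i≡v , i≢v , _) = i≢v i≡v

    source : ∀ {L L′} → Transition L L′ → Configuration P N
    source {L} t = starGraph L v R? where open Transition t

    -- A step reads only the edges of its source, so `γ` may carry any edges, and each configuration
    -- can take its graph from the transition that leaves it.
    source-step : ∀ {L} γ (t : Transition L (Configuration.L γ)) → Step P (source t) γ
    source-step γ t = record
      { v          = v
      ; m          = m
      ; broadcasts = broadcasts
      ; receives   = λ i i≢v → λ where
          (inj₁ (_ , _ , Ri))  → receives i i≢v Ri
          (inj₂ (i≡v , _ , _)) → contradiction i≡v i≢v
      ; idles      = λ i i≢v ¬E → idles i i≢v λ Ri → ¬E (inj₁ (refl , i≢v , Ri))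
      }
      where open Transition t

    record Trace (ℓ : ℕ) (L L′ : Vector Q N) : Set₁ where
      field
        configs : Vector (Configuration P N) (suc ℓ)
        starts  : Configuration.L (configs Fin.zero) ≡ L
        ends    : Configuration.L (configs (fromℕ ℓ)) ≡ L′
        steps   : ∀ i → Step P (configs (inject₁ i)) (configs (suc i))

    edgeless : Vector Q N → Configuration P N
    edgeless L = record
      { E = λ _ _ → ⊥ ; E? = λ _ _ → no λ () ; E-sym = id ; E-irrefl = λ _ () ; L = L }

    trace : ∀ {ℓ L L′} → Run ℓ L L′ → Trace ℓ L L′
    trace {L = L} [] = record
      -- No transition leaves the last configuration, so its graph is arbitrary.
      { configs = const (edgeless L) ; starts = refl ; ends = refl ; steps = λ () }
    trace (t ∷ ts) with trace ts
    -- Matching `starts` with `refl` makes the target of `t` the labelling of the next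
    -- configuration, as `source-step` requires.
    ... | record { configs = γs ; starts = refl ; ends = ends ; steps = steps } = record
      { configs = source t Vector.∷ γs
      ; starts  = refl
      ; ends    = ends
      ; steps   = λ { Fin.zero → source-step (γs Fin.zero) t ; (suc i) → steps i }
      }

    -- The listed nodes broadcast in turn without neighbours, so each changes only its own label and
    -- the hypothesis on the others survives. A node listed twice is already right the second time
    -- and is skipped.
    broadcast-among : ∀ (is : List (Fin N)) (L L′ : Vector Q N) →
      (∀ i → L i ≡ L′ i ⊎ i ∈ˡ is × ∃[ m ] Δ (L i) (!! m) (L′ i)) →
      ∃[ ℓ ] ∃[ L″ ] Run ℓ L L″ × ℓ ≤ List.length is × L″ ≗ L′
    broadcast-among [] L L′ h = 0 , L , [] , z≤n , λ i → [ id , (λ ()) ]′ (h i)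
    broadcast-among (j ∷ js) L L′ h with h j
    ... | inj₁ Lj≡ = let ℓ , L″ , run , ℓ≤ , eq = broadcast-among js L L′ h′
                     in ℓ , L″ , run , ℕ.m≤n⇒m≤1+n ℓ≤ , eq
      where
      h′ : ∀ i → L i ≡ L′ i ⊎ i ∈ˡ js × ∃[ m ] Δ (L i) (!! m) (L′ i)
      h′ i with h i
      ... | inj₁ eq                = inj₁ eq
      ... | inj₂ (here refl , _)   = inj₁ Lj≡
      ... | inj₂ (there i∈js , δ)  = inj₂ (i∈js , δ)
    ... | inj₂ (_ , m , δ) = let ℓ , L″ , run , ℓ≤ , eq = broadcast-among js L₁ L′ h′
                             in suc ℓ , L″ , t ∷ run , s≤s ℓ≤ , eq
      where
      L₁ : Vector Q N
      L₁ = updateAt L j (const (L′ j))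

      t : Transition L L₁
      t = record
        { v          = j
        ; m          = m
        ; R          = λ _ → ⊥
        ; R?         = λ _ → no λ ()
        ; broadcasts = subst (Δ (L j) (!! m)) (sym (updateAt-updates j L)) δ
        ; receives   = λ _ _ ()
        ; idles      = λ i i≢j _ → updateAt-minimal i j L i≢j
        }
  
      h′ : ∀ i → L₁ i ≡ L′ i ⊎ i ∈ˡ js × ∃[ m ] Δ (L₁ i) (!! m) (L′ i)
      h′ i with i ≟ j
      ... | yes refl = inj₁ (updateAt-updates j L)
      ... | no  i≢j rewrite updateAt-minimal i j {const (L′ j)} L i≢j with h i
      ...   | inj₁ eq               = inj₁ eq
      ...   | inj₂ (here i≡j , _)   = contradiction i≡j i≢j
      ...   | inj₂ (there i∈js , δ) = inj₂ (i∈js , δ)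

    broadcast-all : (L L′ : Vector Q N) →
      (∀ i → L i ≡ L′ i ⊎ ∃[ m ] Δ (L i) (!! m) (L′ i)) →
      ∃[ ℓ ] ∃[ L″ ] Run ℓ L L″ × ℓ ≤ N × L″ ≗ L′
    broadcast-all L L′ h =
      let ℓ , L″ , run , ℓ≤ , eq = broadcast-among (allFin N) L L′ h′
      in ℓ , L″ , run , subst (ℓ ≤_) (length-tabulate id) ℓ≤ , eq
      where
      h′ : ∀ i → L i ≡ L′ i ⊎ i ∈ˡ allFin N × ∃[ m ] Δ (L i) (!! m) (L′ i)
      h′ i = [ inj₁ , inj₂ ∘ (∈-allFin i ,_) ]′ (h i)

    -- Reaching labellings that meet a demand.

    record Reach (ℓ : ℕ) (C : Pred (Vector Q N) 0ℓ) : Set₁ where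
      field
        {start end} : Vector Q N
        {length}    : ℕ
        initial     : ∀ i → start i ∈ I
        run         : Run length start end
        length≤     : length ≤ ℓ
        satisfied   : C end

    -- The bound is `k + ℓ` rather than `ℓ + k` so that adding `N` steps to `k * N` gives
    -- `suc k * N` by computation.
    extend : ∀ {k ℓ} {C D : Pred (Vector Q N) 0ℓ} → Reach ℓ C →
             (∀ {L} → C L → ∃[ j ] ∃[ L′ ] Run j L L′ × j ≤ k × D L′) → Reach (k + ℓ) D
    extend {k} {ℓ} r f = let j , _ , run′ , j≤ , d = f satisfied in record
      { initial   = initial
      ; run       = run ++ run′
      ; length≤   = subst (length + j ≤_) (ℕ.+-comm ℓ k) (ℕ.+-mono-≤ length≤ j≤)
      ; satisfied = d
      }
      where open Reach r

  Meets : ∀ {N} → ℕ → Vector Q N → Vector Q N → Set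
  Meets k D L = ∀ i → k ≤ toℕ i → L i ≡ D i

  -- The nodes below k carry no demand: they serve as helpers of the k
  -- iterations that produced S.
  Attainable : ℕ → Subset ∣Q∣ → Set₁
  Attainable k S = ∀ {N} → k < N → (D : Vector Q N) → (∀ i → k ≤ toℕ i → D i ∈ S) →
                   Reach (k * N) (Meets k D)

  -- With `k = 0` every node carries a demand in `I`, so the demand is itself an initial labelling.
  attainable-initial : Attainable 0 I
  attainable-initial _ D D∈I = record
    { initial = λ i → D∈I i z≤n ; run = [] ; length≤ = z≤n ; satisfied = λ _ _ → refl }

  -- Carrying a demand across one iteration.

  module _ {k N : ℕ} (q : Q) (D : Vector Q N) where

    Pending : Pred (Fin N) 0ℓ
    Pending i = suc k ≤ toℕ i × D i ≡ q

    Pending? : Decidable Pending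
    Pending? i = (suc k ≤? toℕ i) ×-dec (D i ≟ q)

    -- The labelling just before the steps of the iteration. Node `k` is free of demands at stage
    -- `suc k` but still controlled at stage `k`, which lets it be put in a state `s` of choice.
    record Prepared (r s : Q) (L : Vector Q N) : Set where
      field
        pending : ∀ i → Pending i → L i ≡ r
        settled : ∀ i → suc k ≤ toℕ i → D i ≢ q → L i ≡ D i
        helper  : ∀ i → toℕ i ≡ k → L i ≡ s

    prepare : ∀ {S r s} → Attainable k S → k < N → r ∈ S → s ∈ S →
              (∀ i → suc k ≤ toℕ i → D i ∈ S ∪ ⁅ q ⁆) → Reach (k * N) (Prepared r s)
    prepare {S} {r} {s} att k<N r∈S s∈S D∈ = record
      { initial = initial ; run = run ; length≤ = length≤ ; satisfied = record
        { pending = λ i p@(k<i , _) → trans (satisfied i (ℕ.<⇒≤ k<i)) (D′-pending i p)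
        ; settled = λ i k<i ≢q → trans (satisfied i (ℕ.<⇒≤ k<i)) (D′-settled i k<i ≢q)
        ; helper  = λ i i≡k →
            trans (satisfied i (ℕ.≤-reflexive (sym i≡k))) (D′-helper i i≡k)
        } }
      where
      D′ : Vector Q N
      D′ i with suc k ≤? toℕ i | D i ≟ q
      ... | yes _ | yes _ = r
      ... | yes _ | no  _ = D i
      -- Besides node `k` this covers the nodes below it, where `Meets k` ignores the demand and `s`
      -- is a mere default.
      ... | no  _ | _     = s

      D′∈ : ∀ i → D′ i ∈ S
      D′∈ i with suc k ≤? toℕ i | D i ≟ q
      ... | yes _   | yes _  = r∈S
      ... | yes k<i | no  ≢q =
        [ id , (λ ∈q → contradiction (x∈⁅y⁆⇒x≡y q ∈q) ≢q) ]′ (x∈p∪q⁻ S ⁅ q ⁆ (D∈ i k<i))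
      ... | no  _   | _      = s∈S

      D′-pending : ∀ i → Pending i → D′ i ≡ r
      D′-pending i (k<i , ≡q) with suc k ≤? toℕ i | D i ≟ q
      ... | yes _  | yes _  = refl
      ... | yes _  | no  ≢q = contradiction ≡q ≢q
      ... | no k≮i | _      = contradiction k<i k≮i

      D′-settled : ∀ i → suc k ≤ toℕ i → D i ≢ q → D′ i ≡ D i
      D′-settled i k<i ≢q with suc k ≤? toℕ i | D i ≟ q
      ... | yes _  | yes ≡q = contradiction ≡q ≢q
      ... | yes _  | no  _  = refl
      ... | no k≮i | _      = contradiction k<i k≮i

      D′-helper : ∀ i → toℕ i ≡ k → D′ i ≡ s
      D′-helper i i≡k with suc k ≤? toℕ i | D i ≟ q
      ... | yes k<i | _ = contradiction (sym i≡k) (ℕ.<⇒≢ k<i)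
      ... | no  _   | _ = refl

      open Reach (att k<N D′ (λ i _ → D′∈ i))

  attainable-broadcast : ∀ {k S} q → BroadcastCandidate P S q → Attainable k S →
                         Attainable (suc k) (S ∪ ⁅ q ⁆)
  attainable-broadcast {k} {S} q (q₁ , m , δ , q₁∈S , _) att {N} k+1<N D D∈ =
    -- The second `q₁∈S` concerns node `k`, of which some state of `S` has to be demanded.
    extend (prepare q D att (ℕ.<⇒≤ k+1<N) q₁∈S q₁∈S D∈) finish
    where
    finish : ∀ {L} → Prepared {k} q D q₁ q₁ L →
             ∃[ j ] ∃[ L′ ] Run j L L′ × j ≤ N × Meets (suc k) D L′
    finish {L} prepared =
      let j , L″ , run , j≤ , eq = broadcast-all L L′ h
      in j , L″ , run , j≤ , λ i k<i → trans (eq i) (meets i k<i)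
      where
      open Prepared prepared

      L′ : Vector Q N
      L′ i with Pending? {k} q D i
      ... | yes _ = q
      ... | no  _ = L i

      h : ∀ i → L i ≡ L′ i ⊎ ∃[ m ] Δ (L i) (!! m) (L′ i)
      h i with Pending? {k} q D i
      ... | yes p = inj₂ (m , subst (λ x → Δ x (!! m) q) (sym (pending i p)) δ)
      ... | no  _ = inj₁ refl

      meets : Meets (suc k) D L′
      meets i k<i with Pending? {k} q D i
      ... | yes (_ , ≡q) = sym ≡q
      ... | no  ¬p       = settled i k<i (¬p ∘ (k<i ,_))

  -- The pending nodes wait in `q₁′` and node `k` in `q₁`. Its broadcast leaves node `k` in `q₂`,
  -- which violates no demand at stage `suc k`; this is how an iteration uses up a node.
  attainable-reception : ∀ {k S} q → ReceptionCandidate P S q → Attainable k S →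
                         Attainable (suc k) (S ∪ ⁅ q ⁆)
  attainable-reception {k} {S} q (q₁ , q₂ , q₁′ , m , δ! , δ? , q₁∈S , _ , q₁′∈S , _)
                       att {N} k+1<N D D∈ =
    extend (prepare q D att k<N q₁′∈S q₁∈S D∈) finish
    where
    k<N : k < N
    k<N = ℕ.<⇒≤ k+1<N

    finish : ∀ {L} → Prepared {k} q D q₁′ q₁ L →
             ∃[ j ] ∃[ L′ ] Run j L L′ × j ≤ N × Meets (suc k) D L′
    finish {L} prepared = 1 , L′ , t ∷ [] , ℕ.≤-trans (s≤s z≤n) k<N , meets
      where
      open Prepared prepared

      b : Fin N
      b = fromℕ< k<N

      L′ : Vector Q N
      L′ i with i ≟ b | Pending? {k} q D i
      ... | yes _ | _     = q₂
      ... | no  _ | yes _ = q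
      ... | no  _ | no  _ = L i

      broadcasts : Δ (L b) (!! m) (L′ b)
      broadcasts with b ≟ b
      ... | yes _   = subst (λ x → Δ x (!! m) q₂) (sym (helper b (toℕ-fromℕ< k<N))) δ!
      ... | no  b≢b = contradiction refl b≢b

      receives : ∀ i → i ≢ b → Pending {k} q D i → Δ (L i) (?? m) (L′ i)
      receives i i≢b p with i ≟ b | Pending? {k} q D i
      ... | yes i≡b | _     = contradiction i≡b i≢b
      ... | no  _   | yes _ = subst (λ x → Δ x (?? m) q) (sym (pending i p)) δ?
      ... | no  _   | no ¬p = contradiction p ¬p

      idles : ∀ i → i ≢ b → ¬ Pending {k} q D i → L′ i ≡ L i
      idles i i≢b ¬p with i ≟ b | Pending? {k} q D i
      ... | yes i≡b | _     = contradiction i≡b i≢b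
      ... | no  _   | yes p = contradiction p ¬p
      ... | no  _   | no  _ = refl

      t : Transition L L′
      t = record
        { v = b ; m = m ; R? = Pending? {k} q D
        ; broadcasts = broadcasts ; receives = receives ; idles = idles }

      meets : Meets (suc k) D L′
      meets i k<i with i ≟ b | Pending? {k} q D i
      -- A node with a demand has index above `k`, so it is not the broadcaster.
      ... | yes refl | _            = contradiction (sym (toℕ-fromℕ< k<N)) (ℕ.<⇒≢ k<i)
      ... | no  _    | yes (_ , ≡q) = sym ≡q
      ... | no  _    | no  ¬p       = settled i k<i (¬p ∘ (k<i ,_))

  -- From saturation runs to covering executions.

  Saturable : Subset ∣Q∣ → Set₁
  Saturable S = ∃[ k ] k ≤ ∣ S ∣ × Attainable k S

  ∉⇒∣p∣<∣p∪⁅x⁆∣ : ∀ {n} {p : Subset n} {x} → x ∉ p → ∣ p ∣ < ∣ p ∪ ⁅ x ⁆ ∣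
  ∉⇒∣p∣<∣p∪⁅x⁆∣ {p = p} {x} x∉p =
    p⊂q⇒∣p∣<∣q∣ (p⊆p∪q ⁅ x ⁆ , x , x∈p∪q⁺ {p = p} (inj₂ (x∈⁅x⁆ x)) , x∉p)

  -- The added state is new, so the set grows whenever `k` does.
  saturable-iteration : ∀ {S c S′ c′} → Iteration P (S , c) (S′ , c′) →
                        Saturable S → Saturable S′
  saturable-iteration (by-broadcast q cand@(_ , _ , _ , _ , q∉S)) (k , k≤ , att) =
    suc k , ℕ.≤-<-trans k≤ (∉⇒∣p∣<∣p∪⁅x⁆∣ q∉S) , attainable-broadcast q cand att
  saturable-iteration (by-reception q _ cand@(_ , _ , _ , _ , _ , _ , _ , _ , _ , q∉S)) (k , k≤ , att) =
    suc k , ℕ.≤-<-trans k≤ (∉⇒∣p∣<∣p∪⁅x⁆∣ q∉S) , attainable-reception q cand att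

  saturable-run : ∀ {S c S′ c′} → Star (Iteration P) (S , c) (S′ , c′) →
                  Saturable S → Saturable S′
  saturable-run ε        sat = sat
  saturable-run (i ◅ is) sat = saturable-run is (saturable-iteration i sat)

  covering-execution : ∀ {k S q} {F : Subset ∣Q∣} → Attainable k S → q ∈ S → q ∈ F →
    ∃[ ρ ] Covers P ρ F × Execution.nodes ρ ≡ suc k × Execution.length ρ ≤ k * suc k
  covering-execution {k} {q = q} att q∈S q∈F = ρ , covers , refl , length≤
    where
    -- Taking `N = suc k` leaves a demand on the last node alone: it must end in `q`.
    open Reach (att ℕ.≤-refl (const q) (λ _ _ → q∈S))
    open Trace (trace run)

    ρ : Execution P
    ρ = record
      { configs = configs
      ; initial = λ { (v , refl) → subst (λ L → L v ∈ I) (sym starts) (initial v) }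
      ; steps   = steps
      }

    covers : Covers P ρ _
    covers = q , (fromℕ k , trans (cong (λ L → L (fromℕ k)) ends)
                                  (satisfied (fromℕ k) (ℕ.≤-reflexive (sym (toℕ-fromℕ k)))))
               , q∈F

-- Numerical bounds and conclusion.

1+m≤2*n : ∀ {m n} → m ≤ n → 0 < n → suc m ≤ 2 * n
1+m≤2*n {m} {n} m≤n 0<n = begin
  1 + m       ≤⟨ ℕ.+-mono-≤ 0<n m≤n ⟩
  n + n       ≡⟨ cong (n +_) (ℕ.+-identityʳ n) ⟨
  2 * n       ∎
  where open ≤-Reasoning

m*[1+m]≤2*n^2 : ∀ {m n} → m ≤ n → 0 < n → m * suc m ≤ 2 * n ^ 2
m*[1+m]≤2*n^2 {m} {n} m≤n 0<n = begin
  m * suc m      ≤⟨ ℕ.*-mono-≤ m≤n (1+m≤2*n m≤n 0<n) ⟩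
  n * (2 * n)    ≡⟨ ℕ.*-comm n (2 * n) ⟩
  2 * n * n      ≡⟨ ℕ.*-assoc 2 n n ⟩
  2 * (n * n)    ≡⟨ cong (λ x → 2 * (n * x)) (ℕ.*-identityʳ n) ⟨
  2 * n ^ 2      ∎
  where open ≤-Reasoning

theorem3p2 : (P : Protocol) (F S : Subset (Protocol.∣Q∣ P)) →
    SaturationReturns P S →
    Nonempty (F ∩ S) →
    ∃[ ρ ] Covers P ρ F
    × Execution.nodes ρ ≤ 2 * Protocol.∣Q∣ P
    × Execution.length ρ ≤ 2 * Protocol.∣Q∣ P ^ 2
theorem3p2 P F S ret (q , q∈F∩S)
  with q∈F , q∈S ← x∈p∩q⁻ F S q∈F∩S
     | k , k≤ , att ← saturable-run P (SaturationReturns.run ret)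
                                      (0 , z≤n , attainable-initial P)
  with ρ , covers , nodes≡ , length≤ ← covering-execution P {F = F} att q∈S q∈F =
    ρ , covers
      , ℕ.≤-trans (ℕ.≤-reflexive nodes≡) (1+m≤2*n k≤∣Q∣ 0<∣Q∣)
      , ℕ.≤-trans length≤ (m*[1+m]≤2*n^2 k≤∣Q∣ 0<∣Q∣)
  where
  0<∣Q∣ : 0 < Protocol.∣Q∣ P
  -- The covered state `q` witnesses that there is a state at all.
  0<∣Q∣ = ℕ.≤-<-trans z≤n (toℕ<n q)

  k≤∣Q∣ : k ≤ Protocol.∣Q∣ P
  k≤∣Q∣ = ℕ.≤-trans k≤ (∣p∣≤n S)
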